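{- Let $k\ge 1$ be an integer and let $GP(3k,k)$ be the generalised Petersen graph. If $k$ is odd, the number of $1$-factorisations of $GP(3k,k)$ equals the Jacobsthal number $J(k)$; if $k$ is even, the number of $1$-factorisations of $GP(3k,k)$ equals $4J(k)$.
   Context: For integers $n,k$ with $1\le k<n/2$, the generalised Petersen graph $GP(n,k)$ has vertex set $\{u_i,v_i : i\in\mathbb{Z}_n\}$ and edge set $\{u_iu_{i+1},\ u_iv_i,\ v_iv_{i+k} : i\in\mathbb{Z}_n\}$ (indices modulo $n$). A $1$-factorisation of a graph is a partition of its edge set into perfect matchings (unordered). The Jacobsthal numbers are defined by $J(0)=0$, $J(1)=1$ and $J(k)=J(k-1)+2J(k-2)$ for $k\ge 2$. -}

module Defs where

open import Data.Bool.Base using (Bool; T)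
open import Data.Fin.Base using (Fin; toℕ)
open import Data.Fin.Properties using (toℕ<n; toℕ-fromℕ<)
open import Data.List.Base using (List)
import Data.List.Membership.Setoid as Membership
import Data.List.Relation.Binary.Subset.Setoid.Properties as Subset
open import Data.Nat.Base using (ℕ; suc; _+_; _*_; _∸_; _≤_; _<_; z≤n; z<s; NonZero; >-nonZero)
open import Data.Nat.DivMod using (_%_; _mod_; m%n<n; m<n⇒m%n≡m; m≤n⇒[n∸m]%m≡n%m)
open import Data.Nat.Properties
  using (_<?_; <⇒≢; ≮⇒≥; ≤-<-trans; m<m+n; m<n+m; m≤n*m; m∸n+n≡m; +-monoʳ-<; +-mono-<; +-cancelʳ-<)
open import Data.Product using (_×_; ∃!)
open import Function.Bundles using (Bijection)
open import Level using (Level; _⊔_; 0ℓ)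
open import Relation.Binary.Bundles using (Setoid)
open import Relation.Binary.Construct.Closure.Symmetric using (SymClosure; fwd; bwd; symmetric)
import Relation.Binary.Construct.On as On
open import Relation.Binary.Core using (Rel)
open import Relation.Binary.Definitions using (Irreflexive; Symmetric)
open import Relation.Binary.Properties.Preorder using (InducedEquivalence)
open import Relation.Binary.PropositionalEquality
  using (_≡_; _≢_; refl; sym; trans; cong; subst; setoid; module ≡-Reasoning)
open import Relation.Nullary.Decidable.Core using (yes; no)

private
  variable
    c ℓ : Level

HasCardinality : Setoid c ℓ → ℕ → Set (c ⊔ ℓ)
HasCardinality S N = Bijection (setoid (Fin N)) S

J : ℕ → ℕ
J 0             = 0
J 1             = 1
J (suc (suc k)) = J (suc k) + 2 * J k

record SimpleGraph : Set₁ where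
  infix 4 _~_
  field
    Vertex   : Set
    _~_      : Rel Vertex 0ℓ
    ~-sym    : Symmetric _~_
    ~-irrefl : Irreflexive _≡_ _~_

module _ (G : SimpleGraph) where
  open SimpleGraph G

  -- A set of edges is given by its characteristic function on pairs of
  -- endpoints, so two matchings are equal when these functions agree pointwise.
  record PerfectMatching : Set where
    field
      joins     : Vertex → Vertex → Bool
      joins-sym : ∀ x y → joins x y ≡ joins y x
      joins⇒~   : ∀ {x y} → T (joins x y) → x ~ y
      perfect   : ∀ x → ∃! _≡_ λ y → T (joins x y)

  open PerfectMatching

  perfectMatchings : Setoid 0ℓ 0ℓ
  perfectMatchings = record
    { Carrier       = PerfectMatching
    ; _≈_           = λ M N → ∀ x y → joins M x y ≡ joins N x y
    ; isEquivalence = record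
      { refl  = λ x y → refl
      ; sym   = λ M≈N x y → sym (M≈N x y)
      ; trans = λ M≈N N≈O x y → trans (M≈N x y) (N≈O x y)
      }
    }

  open Setoid perfectMatchings using (_≈_)
  open Membership perfectMatchings using (_∈_)

  -- The list stands for the finite set of its members: repetitions and order
  -- are ignored, both in `partition` (through uniqueness up to _≈_) and in the
  -- equality of `oneFactorisations`, which is mutual inclusion.  The blocks of
  -- the partition are nonempty as soon as G has a vertex, by `perfect`.
  record OneFactorisation : Set where
    field
      factors   : List PerfectMatching
      partition : ∀ {x y} → x ~ y → ∃! _≈_ λ M → M ∈ factors × T (joins M x y)

  oneFactorisations : Setoid 0ℓ 0ℓ
  oneFactorisations =
    On.setoid (InducedEquivalence (Subset.⊆-preorder perfectMatchings))
              OneFactorisation.factors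

module _ {n : ℕ} .{{_ : NonZero n}} where

  infixl 6 _⊕_

  _⊕_ : Fin n → ℕ → Fin n
  i ⊕ m = (toℕ i + m) mod n

  i⊕m≢i : ∀ {m} → 0 < m → m < n → (i : Fin n) → i ⊕ m ≢ i
  i⊕m≢i {m} 0<m m<n i i⊕m≡i with toℕ i + m <? n
  ... | yes a+m<n = <⇒≢ (m<m+n (toℕ i) 0<m) (sym (trans (sym (m<n⇒m%n≡m a+m<n)) [a+m]%n≡a))
    where
    [a+m]%n≡a : (toℕ i + m) % n ≡ toℕ i
    [a+m]%n≡a = trans (sym (toℕ-fromℕ< (m%n<n (toℕ i + m) n))) (cong toℕ i⊕m≡i)
  ... | no  a+m≮n = <⇒≢ a+m<a+n (trans (sym (m∸n+n≡m n≤a+m)) (cong (_+ n) a+m∸n≡a))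
    where
    n≤a+m : n ≤ toℕ i + m
    n≤a+m = ≮⇒≥ a+m≮n

    a+m<a+n : toℕ i + m < toℕ i + n
    a+m<a+n = +-monoʳ-< (toℕ i) m<n

    a+m∸n<n : toℕ i + m ∸ n < n
    a+m∸n<n = +-cancelʳ-< n _ _ (subst (_< n + n) (sym (m∸n+n≡m n≤a+m))
                (+-mono-< (toℕ<n i) m<n))

    a+m∸n≡a : toℕ i + m ∸ n ≡ toℕ i
    a+m∸n≡a = begin
      toℕ i + m ∸ n        ≡⟨ m<n⇒m%n≡m a+m∸n<n ⟨
      (toℕ i + m ∸ n) % n  ≡⟨ m≤n⇒[n∸m]%m≡n%m n≤a+m ⟩
      (toℕ i + m) % n      ≡⟨ toℕ-fromℕ< (m%n<n (toℕ i + m) n) ⟨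
      toℕ (i ⊕ m)          ≡⟨ cong toℕ i⊕m≡i ⟩
      toℕ i                ∎
      where open ≡-Reasoning

data GPVertex (n : ℕ) : Set where
  u v : Fin n → GPVertex n

data GPEdge (n k : ℕ) .{{_ : NonZero n}} : Rel (GPVertex n) 0ℓ where
  outer : ∀ {i j} → i ⊕ 1 ≡ j → GPEdge n k (u i) (u j)
  spoke : ∀ {i}               → GPEdge n k (u i) (v i)
  inner : ∀ {i j} → i ⊕ k ≡ j → GPEdge n k (v i) (v j)

GPEdge-irrefl : ∀ {n k} .{{_ : NonZero n}} → 1 ≤ k → k < n →
                Irreflexive _≡_ (GPEdge n k)
GPEdge-irrefl 1≤k k<n refl (outer {i} i⊕1≡i) = i⊕m≢i z<s (≤-<-trans 1≤k k<n) i i⊕1≡i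
GPEdge-irrefl 1≤k k<n refl (inner {i} i⊕k≡i) = i⊕m≢i 1≤k k<n i i⊕k≡i

GP : (n k : ℕ) → 1 ≤ k → 2 * k < n → SimpleGraph
GP n k 1≤k 2k<n = record
  { Vertex   = GPVertex n
  ; _~_      = SymClosure (GPEdge n k)
  ; ~-sym    = symmetric (GPEdge n k)
  ; ~-irrefl = λ where
      x≡y (fwd e) → GPEdge-irrefl 1≤k k<n x≡y e
      x≡y (bwd e) → GPEdge-irrefl 1≤k k<n (sym x≡y) e
  }
  where
  k<n : k < n
  k<n = ≤-<-trans (m≤n*m k 2) 2k<n

  instance
    n≢0 : NonZero n
    n≢0 = >-nonZero (≤-<-trans z≤n 2k<n)

2k<3k : ∀ {k} → 1 ≤ k → 2 * k < 3 * k
2k<3k {k} 1≤k = m<n+m (2 * k) 1≤k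

{-# OPTIONS --safe #-}
module Submission where

-- In a proper 3-edge-colouring of GP(3k,k) every inner triangle uses all three
-- colours, so it is determined by its three spokes, which must have different
-- colours.  Cutting the outer cycle into three rows of length k, the colouring
-- becomes a closed sequence E₀, …, E_k of triples of colours: consecutive triples
-- differ in every row, their missing colours are distinct, and E_k is E₀ with
-- the rows rotated.  Such a step preserves the type of a triple: either its
-- entries are all different and get rotated by ±1, or exactly two of them agree,
-- and then the position of the odd entry moves by ±1 while the repeated colour is
-- replaced by the colour not occurring.  Hence, up to permuting colours, a
-- sequence is a walk on the triangle ℤ/3 of length k from p to p + 2; there are
-- J k of those.  The first type contributes one starting point p, the second
-- three, but the second closes up only for even k.

open import Defs
open import Data.Bool.Base using (Bool; T; false; if_then_else_; not; true)
import Data.Bool.Properties as Bool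
open import Data.Fin.Base
  using (Fin; combine; fromℕ; inject₁; punchOut; remQuot; suc; toℕ; zero)
open import Data.Fin.Patterns using (0F; 1F; 2F)
open import Data.Fin.Properties
  using (*↔×; +↔⊎; _≟_; all?; any?; combine-surjective; injective⇒≤; punchOut-injective;
         remQuot-combine; toℕ-combine; toℕ-fromℕ; toℕ-fromℕ<; toℕ-injective; toℕ-inject₁;
         toℕ<n)
open import Data.Fin.Relation.Unary.Top using (view; ‵fromℕ; ‵inject₁)
open import Data.List.Base using (tabulate)
import Data.List.Membership.Setoid as Membership
import Data.List.Membership.Setoid.Properties as Membershipₚ
open import Data.Nat.Base using (NonZero; _*_; _+_; _<_; _≤_; suc; s≤s; zero; z≤n; ℕ)
open import Data.Nat.DivMod
  using (%-distribˡ-+; [m+kn]%n≡m%n; _%_; _mod_; m%n%n≡m%n; m%n<n; m<n⇒m%n≡m)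
open import Data.Nat.Divisibility using (_∣0; _∣_; divides; ∣-refl; ∣m∣n⇒∣m+n)
open import Data.Nat.Properties using (+-assoc; +-comm; +-identityʳ; 0<1+n; <⇒≱; m<m+n; n<1+n)
open import Data.Nat.Tactic.RingSolver using (solve-∀)
open import Data.Product.Base using (_,_; _×_; map₂; proj₁; proj₂; Σ; ∃; ∃₂)
open import Data.Product.Function.Dependent.Propositional using () renaming (cong to cong↔)
open import Data.Sum.Base using (_⊎_; inj₁; inj₂)
open import Data.Sum.Function.Propositional using (_⊎-cong_)
open import Function.Base using (_∘_; id)
open import Function.Bundles using (_↔_; mk↔ₛ′)
open import Function.Construct.Composition using (_↔-∘_; bijection)
open import Function.Construct.Identity using (↔-id)
open import Function.Definitions using (Injective)
open import Function.Properties.Inverse using (Inverse⇒Bijection)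
open import Relation.Binary.Bundles using (Setoid)
open import Relation.Binary.Construct.Closure.Symmetric using (bwd; fwd)
open import Relation.Binary.Definitions using (DecidableEquality)
open import Relation.Binary.PropositionalEquality hiding (J)
open import Relation.Nullary.Decidable
  using (Dec; True; _×-dec_; _→-dec_; _⊎-dec_; dec-false; dec-true; does; fromWitness;
         map′; no; toWitness; yes; ¬?; ⌊_⌋)
open import Relation.Nullary.Negation using (contradiction; ¬_)

-- Booleans, injections of finite sets, proofs by evaluation.

T-injective : ∀ {a b} → (T a → T b) → (T b → T a) → a ≡ b
T-injective {false} {false} _ _ = refl
T-injective {false} {true}  _ g = contradiction (g _) λ ()
T-injective {true}  {false} f _ = contradiction (f _) λ ()
T-injective {true}  {true}  _ _ = refl

-- If `y` were missed, punching it out of the codomain would inject `Fin (suc n)` into `Fin n`.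
injective⇒surjective : ∀ {n} {f : Fin n → Fin n} → Injective _≡_ _≡_ f →
                       ∀ y → ∃ λ x → f x ≡ y
injective⇒surjective {suc n} {f} f-inj y with any? (λ x → f x ≟ y)
... | yes (x , fx≡y) = x , fx≡y
... | no  y∉f          = contradiction (injective⇒≤ g-inj) (<⇒≱ (n<1+n n))
  where
  y≢f : ∀ x → y ≢ f x
  y≢f x y≡fx = y∉f (x , sym y≡fx)

  g-inj : Injective _≡_ _≡_ (λ x → punchOut (y≢f x))
  g-inj {a} {b} = f-inj ∘ punchOut-injective (y≢f a) (y≢f b)

-- Runs a decision procedure during type checking; all exhaustive checks over colours and states go
-- through it.
decide : ∀ {A : Set} (a? : Dec A) {_ : True a?} → A
decide a? {t} = toWitness t

-- Colours, states and steps between states.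

-- The colour different from both a and b; third a a = a.
third : Fin 3 → Fin 3 → Fin 3
third a b = (2 * (toℕ a + toℕ b)) mod 3

third-≢ : ∀ a b → a ≢ b → a ≢ third a b × b ≢ third a b
third-≢ = decide (all? λ a → all? λ b →
  ¬? (a ≟ b) →-dec ¬? (a ≟ third a b) ×-dec ¬? (b ≟ third a b))

third-unique : ∀ a b c → a ≢ b → a ≢ c → b ≢ c → third a b ≡ c
third-unique = decide (all? λ a → all? λ b → all? λ c →
  ¬? (a ≟ b) →-dec ¬? (a ≟ c) →-dec ¬? (b ≟ c) →-dec third a b ≟ c)

-- The colours of the outer edges entering u_r, u_{k+r} and u_{2k+r}.
State : Set
State = Fin 3 → Fin 3

⟨_,_,_⟩ : Fin 3 → Fin 3 → Fin 3 → State
⟨ a , b , c ⟩ 0F = a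
⟨ a , b , c ⟩ 1F = b
⟨ a , b , c ⟩ 2F = c

-- Exhaustive checks range over triples of colours; this pointwise equality carries their results to
-- arbitrary states.
η : ∀ (S : State) j → ⟨ S 0F , S 1F , S 2F ⟩ j ≡ S j
η S 0F = refl
η S 1F = refl
η S 2F = refl

Distinct : ∀ {A : Set} → (Fin 3 → A) → Set
Distinct f = f 0F ≢ f 1F × f 1F ≢ f 2F × f 0F ≢ f 2F

distinct? : (S : State) → Dec (Distinct S)
distinct? S = ¬? (S 0F ≟ S 1F) ×-dec ¬? (S 1F ≟ S 2F) ×-dec ¬? (S 0F ≟ S 2F)

Distinct⇒Injective : ∀ {A : Set} {f : Fin 3 → A} → Distinct f → Injective _≡_ _≡_ f
Distinct⇒Injective (≢₁ , ≢₂ , ≢₃) {0F} {0F} _  = refl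
Distinct⇒Injective (≢₁ , ≢₂ , ≢₃) {0F} {1F} eq = contradiction eq ≢₁
Distinct⇒Injective (≢₁ , ≢₂ , ≢₃) {0F} {2F} eq = contradiction eq ≢₃
Distinct⇒Injective (≢₁ , ≢₂ , ≢₃) {1F} {0F} eq = contradiction (sym eq) ≢₁
Distinct⇒Injective (≢₁ , ≢₂ , ≢₃) {1F} {1F} _  = refl
Distinct⇒Injective (≢₁ , ≢₂ , ≢₃) {1F} {2F} eq = contradiction eq ≢₂
Distinct⇒Injective (≢₁ , ≢₂ , ≢₃) {2F} {0F} eq = contradiction (sym eq) ≢₃
Distinct⇒Injective (≢₁ , ≢₂ , ≢₃) {2F} {1F} eq = contradiction (sym eq) ≢₂
Distinct⇒Injective (≢₁ , ≢₂ , ≢₃) {2F} {2F} _  = refl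

Injective⇒Distinct : ∀ {A : Set} {f : Fin 3 → A} → Injective _≡_ _≡_ f → Distinct f
Injective⇒Distinct inj =
  (λ eq → contradiction (inj eq) λ ()) ,
  (λ eq → contradiction (inj eq) λ ()) ,
  (λ eq → contradiction (inj eq) λ ())

-- third (S j) (S′ j) is the colour of the spoke in row j.
Step : State → State → Set
Step S S′ = (∀ j → S j ≢ S′ j) × Distinct (λ j → third (S j) (S′ j))

step? : ∀ S S′ → Dec (Step S S′)
step? S S′ = all? (λ j → ¬? (S j ≟ S′ j)) ×-dec distinct? (λ j → third (S j) (S′ j))

Step-resp : ∀ {S S′ T T′} → (∀ j → S j ≡ T j) → (∀ j → S′ j ≡ T′ j) → Step S S′ → Step T T′
Step-resp {S} {S′} {T} {T′} S≗T S′≗T′ (≢ , ≢₁ , ≢₂ , ≢₃) =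
  (λ j eq → ≢ j (trans (S≗T j) (trans eq (sym (S′≗T′ j))))) ,
  ≢₁ ∘ pull 0F 1F , ≢₂ ∘ pull 1F 2F , ≢₃ ∘ pull 0F 2F
  where
  pull : ∀ i j → third (T i) (T′ i) ≡ third (T j) (T′ j) → third (S i) (S′ i) ≡ third (S j) (S′ j)
  pull i j eq = trans (cong₂ third (S≗T i) (S′≗T′ i))
    (trans eq (sym (cong₂ third (S≗T j) (S′≗T′ j))))

all-states? : ∀ {P : State → Set} → (∀ S → Dec (P S)) → Dec (∀ a b c → P ⟨ a , b , c ⟩)
all-states? P? = all? λ a → all? λ b → all? λ c → P? ⟨ a , b , c ⟩

any-state? : ∀ {P : State → Set} → (∀ S → Dec (P S)) → Dec (∃ λ a → ∃₂ λ b c → P ⟨ a , b , c ⟩)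
any-state? P? = any? λ a → any? λ b → any? λ c → P? ⟨ a , b , c ⟩

all-bools? : ∀ {P : Bool → Set} → (∀ b → Dec (P b)) → Dec (∀ b → P b)
all-bools? P? = map′ (λ (f , t) → λ where
                       false → f
                       true  → t)
                     (λ f → f false , f true) (P? false ×-dec P? true)

-- Normal forms of states up to permuting colours.

-- The states with all entries different (type 0) or exactly two equal (types
-- suc p, where p is the initial position of the odd entry), with the colours
-- permuted so that a sequence starts from ρ t false (start t).  The Boolean is
-- the parity of the time, and the last argument is the current position.
ρ : Fin 4 → Bool → Fin 3 → State
ρ zero    _ p j = j ⊕ (2 * toℕ p)
ρ (suc _) b p j = if does (j ≟ p) then 1F else if b then 2F else 0F

start : Fin 4 → Fin 3
start zero    = 0F
start (suc p) = p

-- Closing up reads the first state one row further, and in every type this amounts to moving the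
-- position by 2.
end : Fin 4 → Fin 3
end t = start t ⊕ 2

-- In the types `suc p` the repeated colour alternates with time, so it must have returned to its
-- initial value; type 0 has no such constraint.
_Closes_ : Fin 4 → Bool → Set
t Closes b = t ≡ 0F ⊎ b ≡ false

-- Abstract, since `with` would otherwise normalise these proofs.
abstract
  -- In type 0 every entry shifts by the same nonzero amount, so the missing colours are as distinct
  -- as the entries. In the types `suc _` the missing colour is the old repeated colour at the old
  -- odd position, the new repeated colour at the new one, and `1F` at the remaining position.
  ρ-step : ∀ t b p (d : Fin 2) → Step (ρ t b p) (ρ t (not b) (p ⊕ suc (toℕ d)))
  ρ-step = decide (all? λ t → all-bools? λ b → all? λ p → all? λ d →
    step? (ρ t b p) (ρ t (not b) (p ⊕ suc (toℕ d))))

  ρ-step⁻¹-⟨⟩ : ∀ t b p a₀ a₁ a₂ → Step (ρ t b p) ⟨ a₀ , a₁ , a₂ ⟩ →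
                ∃ λ (d : Fin 2) → ∀ j → ρ t (not b) (p ⊕ suc (toℕ d)) j ≡ ⟨ a₀ , a₁ , a₂ ⟩ j
  ρ-step⁻¹-⟨⟩ = decide (all? λ t → all-bools? λ b → all? λ p → all-states? λ S′ → step? (ρ t b p) S′ →-dec
    any? {n = 2} λ d → all? λ j → ρ t (not b) (p ⊕ suc (toℕ d)) j ≟ S′ j)

  ρ-injective : ∀ t b p (d d′ : Fin 2) →
                (∀ j → ρ t b (p ⊕ suc (toℕ d)) j ≡ ρ t b (p ⊕ suc (toℕ d′)) j) → d ≡ d′
  ρ-injective = decide (all? λ t → all-bools? λ b → all? λ p → all? λ d → all? λ d′ →
    all? (λ j → ρ t b (p ⊕ suc (toℕ d)) j ≟ ρ t b (p ⊕ suc (toℕ d′)) j) →-dec d ≟ d′)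

  -- The successor rules out constant triples: from such a triple all three missing colours would
  -- lie among the two other colours and could not be distinct.
  normalise-⟨⟩ : ∀ a b c a′ b′ c′ → Step ⟨ a , b , c ⟩ ⟨ a′ , b′ , c′ ⟩ →
                 ∃ λ t → ∃ λ x → ∃₂ λ y z → Distinct ⟨ x , y , z ⟩ ×
                 (∀ j → ρ t false (start t) j ≡ ⟨ x , y , z ⟩ (⟨ a , b , c ⟩ j))
  normalise-⟨⟩ = decide (all-states? λ S → all-states? λ S′ → step? S S′ →-dec
    any? {n = 4} λ t → any-state? λ π → distinct? π ×-dec all? λ j → ρ t false (start t) j ≟ π (S j))

  -- Permuting colours preserves which entries agree, and this pattern determines the type. At least
  -- two colours occur in a starting state; a permutation fixing these fixes the third.
  normal-unique-⟨⟩ : ∀ t t′ x y z → Distinct ⟨ x , y , z ⟩ →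
                     (∀ j → ρ t′ false (start t′) j ≡ ⟨ x , y , z ⟩ (ρ t false (start t) j)) →
                     t ≡ t′ × ∀ c → ⟨ x , y , z ⟩ c ≡ c
  normal-unique-⟨⟩ = decide (all? {n = 4} λ t → all? {n = 4} λ t′ → all-states? λ π → distinct? π →-dec
    all? (λ j → ρ t′ false (start t′) j ≟ π (ρ t false (start t) j)) →-dec
    t ≟ t′ ×-dec all? λ c → π c ≟ c)

  ρ-closes : ∀ t b → t Closes b → ∀ j → ρ t b (end t) j ≡ ρ t false (start t) (j ⊕ 1)
  ρ-closes = decide (all? λ t → all-bools? λ b → (t ≟ 0F ⊎-dec b Bool.≟ false) →-dec
    all? λ j → ρ t b (end t) j ≟ ρ t false (start t) (j ⊕ 1))

  ρ-closes⁻¹ : ∀ t b p → (∀ j → ρ t b p j ≡ ρ t false (start t) (j ⊕ 1)) → p ≡ end t × t Closes b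
  ρ-closes⁻¹ = decide (all? λ t → all-bools? λ b → all? λ p →
    all? (λ j → ρ t b p j ≟ ρ t false (start t) (j ⊕ 1)) →-dec p ≟ end t ×-dec (t ≟ 0F ⊎-dec b Bool.≟ false))

  other : (x y : Fin 3) → x ≢ y → (x ⊕ 1 ≡ y × x ⊕ 2 ≢ y) ⊎ (x ⊕ 2 ≡ y × x ⊕ 1 ≢ y)
  other = decide (all? λ x → all? λ y → ¬? (x ≟ y) →-dec
    ((x ⊕ 1 ≟ y ×-dec ¬? (x ⊕ 2 ≟ y)) ⊎-dec (x ⊕ 2 ≟ y ×-dec ¬? (x ⊕ 1 ≟ y))))

ρ-step⁻¹ : ∀ t b p (S′ : State) → Step (ρ t b p) S′ →
           ∃ λ (d : Fin 2) → ∀ j → ρ t (not b) (p ⊕ suc (toℕ d)) j ≡ S′ j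
ρ-step⁻¹ t b p S′ st
  with d , eq ← ρ-step⁻¹-⟨⟩ t b p (S′ 0F) (S′ 1F) (S′ 2F)
                  (Step-resp (λ _ → refl) (sym ∘ η S′) st) =
  d , λ j → trans (eq j) (η S′ j)

normalise : ∀ S S′ → Step S S′ → ∃₂ λ t π → Distinct π × (∀ j → ρ t false (start t) j ≡ π (S j))
normalise S S′ st
  with t , a , b , c , inj , eq ← normalise-⟨⟩ (S 0F) (S 1F) (S 2F) (S′ 0F) (S′ 1F) (S′ 2F)
                                    (Step-resp (sym ∘ η S) (sym ∘ η S′) st) =
  t , ⟨ a , b , c ⟩ , inj , λ j → trans (eq j) (cong ⟨ a , b , c ⟩ (η S j))

normal-unique : ∀ t t′ π → Distinct π → (∀ j → ρ t′ false (start t′) j ≡ π (ρ t false (start t) j)) →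
                t ≡ t′ × ∀ c → π c ≡ c
normal-unique t t′ π inj eq
  with refl , id ← normal-unique-⟨⟩ t t′ (π 0F) (π 1F) (π 2F) inj (λ j → trans (eq j) (sym (η π _))) =
  refl , λ c → trans (sym (η π c)) (id c)

-- Walks on the triangle and the state sequences they trace.

-- Walks on the triangle ℤ/3 that end in y.
data Walk (y : Fin 3) : ℕ → Fin 3 → Set where
  stop : Walk y 0 y
  step : ∀ {n x} (d : Fin 2) → Walk y n (x ⊕ suc (toℕ d)) → Walk y (suc n) x

states : ∀ {y n x} → Fin 4 → Bool → Walk y n x → Fin (suc n) → State
states {x = x} t b w        zero    = ρ t b x
states         t b (step _ w) (suc r) = states t (not b) w r

states-step : ∀ {y n x} t b (w : Walk y n x) r → Step (states t b w (inject₁ r)) (states t b w (suc r))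
states-step {x = x} t b (step d w)            zero    = ρ-step t b x d
states-step         t b (step d w@(step _ _)) (suc r) = states-step t (not b) w r

phase : Bool → ℕ → Bool
phase b zero    = b
phase b (suc n) = phase (not b) n

states-end : ∀ {y n x} t b (w : Walk y n x) → states t b w (fromℕ n) ≡ ρ t (phase b n) y
states-end t b stop       = refl
states-end t b (step _ w) = states-end t (not b) w

states-injective : ∀ {y n x} t b (w w′ : Walk y n x) →
                   (∀ r j → states t b w r j ≡ states t b w′ r j) → w ≡ w′
states-injective t b stop stop _ = refl
states-injective {x = x} t b (step d w) (step d′ w′) eq
  with refl ← ρ-injective t (not b) x d d′ (eq (suc zero)) =
  cong (step d) (states-injective t (not b) w w′ (λ r → eq (suc r)))

-- The walk is read off one step at a time, since `ρ-step⁻¹` recovers each move from the next state.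
-- Its end `y` is an output: only the closing condition identifies it.
walk : ∀ n {x} t b (E : Fin (suc n) → State) → (∀ j → ρ t b x j ≡ E zero j) →
       (∀ r → Step (E (inject₁ r)) (E (suc r))) →
       ∃₂ λ y (w : Walk y n x) → ∀ r j → states t b w r j ≡ E r j
walk zero {x} t b E E₀ _ = x , stop , λ where zero → E₀
walk (suc n) {x} t b E E₀ Es
  with d , E₁ ← ρ-step⁻¹ t b x (E 1F) (Step-resp (sym ∘ E₀) (λ _ → refl) (Es zero))
  with y , w , eq ← walk n t (not b) (E ∘ suc) E₁ (Es ∘ suc) =
  y , step d w , λ where
    zero    → E₀
    (suc r) → eq r

phase-even : ∀ n → phase false n ≡ false → 2 ∣ n
phase-even zero          _  = 2 ∣0
phase-even (suc (suc n)) eq = ∣m∣n⇒∣m+n ∣-refl (phase-even n eq)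

even-phase : ∀ {n} → 2 ∣ n → phase false n ≡ false
even-phase (divides zero    refl) = refl
even-phase (divides (suc q) refl) = even-phase (divides q refl)

-- Counting walks by Jacobsthal numbers.

#walks : Fin 3 → ℕ → Fin 3 → ℕ
#walks y zero    x = if does (x ≟ y) then 1 else 0
#walks y (suc n) x = #walks y n (x ⊕ 1) + #walks y n (x ⊕ 2)

Fin↔Walk : ∀ y n x → Fin (#walks y n x) ↔ Walk y n x
Fin↔Walk y zero x with x ≟ y
... | yes refl = mk↔ₛ′ (λ _ → stop) (λ _ → zero) (λ where stop → refl) (λ where zero → refl)
... | no  x≢y  = mk↔ₛ′ (λ ()) (λ w → contradiction (stop-≡ w) x≢y)
                   (λ w → contradiction (stop-≡ w) x≢y) (λ ())
  where
  stop-≡ : Walk y 0 x → x ≡ y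
  stop-≡ stop = refl
Fin↔Walk y (suc n) x =
  mk↔ₛ′ (λ where (inj₁ w) → step 0F w
                 (inj₂ w) → step 1F w)
        (λ where (step 0F w) → inj₁ w
                 (step 1F w) → inj₂ w)
        (λ where (step 0F w) → refl
                 (step 1F w) → refl)
        (λ where (inj₁ w) → refl
                 (inj₂ w) → refl)
  ↔-∘ ((Fin↔Walk y n (x ⊕ 1) ⊎-cong Fin↔Walk y n (x ⊕ 2)) ↔-∘ +↔⊎)

x⊕1≢x : (x : Fin 3) → x ⊕ 1 ≢ x
x⊕1≢x = i⊕m≢i (s≤s z≤n) (s≤s (s≤s z≤n))

x⊕2≢x : (x : Fin 3) → x ⊕ 2 ≢ x
x⊕2≢x = i⊕m≢i (s≤s z≤n) (s≤s (s≤s (s≤s z≤n)))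

-- The number of closed walks of a given length.
#closed : ℕ → ℕ
#closed zero    = 1
#closed (suc n) = 2 * J n

J-suc : ∀ n → J (suc n) ≡ J n + #closed n
J-suc zero    = refl
J-suc (suc n) = refl

mutual
  -- One of the two first steps lands on `y` and leaves a closed walk to count, the other lands on
  -- the third vertex; `J-suc` is the resulting recurrence.
  #walks-≢ : ∀ n {x y : Fin 3} → x ≢ y → #walks y n x ≡ J n
  #walks-≢ zero    {x} {y} x≢y = cong (λ b → if b then 1 else 0) (dec-false (x ≟ y) x≢y)
  #walks-≢ (suc n) {x} {y} x≢y with other x y x≢y
  ... | inj₁ (refl , ≢y) = trans (cong₂ _+_ (#walks-≡ n y) (#walks-≢ n ≢y))
                             (trans (+-comm (#closed n) (J n)) (sym (J-suc n)))
  ... | inj₂ (refl , ≢y) = trans (cong₂ _+_ (#walks-≢ n ≢y) (#walks-≡ n y)) (sym (J-suc n))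

  #walks-≡ : ∀ n (y : Fin 3) → #walks y n y ≡ #closed n
  #walks-≡ zero    y = cong (λ b → if b then 1 else 0) (dec-true (y ≟ y) refl)
  #walks-≡ (suc n) y = cong₂ _+_ (#walks-≢ n (x⊕1≢x y))
    (trans (#walks-≢ n (x⊕2≢x y)) (sym (+-identityʳ (J n))))

-- 1-factorisations of a cubic graph as 3-edge-colourings up to permuting colours.

-- The three darts leaving x lead to nb x d, and op d is the reverse of a dart d.
module Cubic
  (G : SimpleGraph)
  (_≟ᵥ_ : DecidableEquality (SimpleGraph.Vertex G))
  (nb : SimpleGraph.Vertex G → Fin 3 → SimpleGraph.Vertex G)
  (nb-injective : ∀ x → Injective _≡_ _≡_ (nb x))
  (op : Fin 3 → Fin 3)
  (nb-op : ∀ x d → nb (nb x d) (op d) ≡ x)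
  (nb⇒~ : ∀ x d → SimpleGraph._~_ G x (nb x d))
  (~⇒nb : ∀ {x y} → SimpleGraph._~_ G x y → ∃ λ d → nb x d ≡ y)
  (x₀ : SimpleGraph.Vertex G)
  where

  open SimpleGraph G
  open PerfectMatching
  open OneFactorisation
  open Setoid (perfectMatchings G) using (_≈_)
  open Membership (perfectMatchings G) using (_∈_)
  open Setoid (oneFactorisations G) using () renaming (_≈_ to _≋_)

  -- A proper 3-edge-colouring, stored on darts: `col-injective` is properness, and `col-op` makes
  -- the colour depend on the edge alone.
  record Colouring : Set where
    field
      col           : Vertex → Fin 3 → Fin 3
      col-injective : ∀ x → Injective _≡_ _≡_ (col x)
      col-op        : ∀ x d → col (nb x d) (op d) ≡ col x d

  open Colouring

  relabel : ∀ π → Injective _≡_ _≡_ π → Colouring → Colouring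
  relabel π π-inj C .col x d         = π (col C x d)
  relabel π π-inj C .col-injective x = col-injective C x ∘ π-inj
  relabel π π-inj C .col-op x d      = cong π (col-op C x d)

  Joins : Colouring → Fin 3 → Vertex → Vertex → Set
  Joins C c x y = ∃ λ d → nb x d ≡ y × col C x d ≡ c

  joins? : ∀ C c x y → Dec (Joins C c x y)
  joins? C c x y = any? λ d → (nb x d ≟ᵥ y) ×-dec (col C x d ≟ c)

  Joins-sym : ∀ C {c x y} → Joins C c x y → Joins C c y x
  Joins-sym C (d , refl , refl) = op d , nb-op _ d , col-op C _ d

  colourClass : Colouring → Fin 3 → PerfectMatching G
  colourClass C c .joins x y = ⌊ joins? C c x y ⌋
  colourClass C c .joins-sym x y = T-injective
    (λ t → fromWitness (Joins-sym C (toWitness t)))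
    (λ t → fromWitness (Joins-sym C (toWitness t)))
  colourClass C c .joins⇒~ {x} t with d , refl , _ ← toWitness t = nb⇒~ x d
  colourClass C c .perfect x with d , col≡c ← injective⇒surjective (col-injective C x) c =
    nb x d , fromWitness (d , refl , col≡c) , unique
    where
    unique : ∀ {y} → T ⌊ joins? C c x y ⌋ → nb x d ≡ y
    unique t with d′ , refl , col′≡c ← toWitness t =
      cong (nb x) (col-injective C x (trans col≡c (sym col′≡c)))

  factor-∈ : ∀ {n} (M : Fin n → PerfectMatching G) c → M c ∈ tabulate M
  factor-∈ M c = Membershipₚ.∈-tabulate⁺ (perfectMatchings G) {f = M} c

  ∈-factor : ∀ {n} (M : Fin n → PerfectMatching G) {N} → N ∈ tabulate M → ∃ λ c → N ≈ M c
  ∈-factor M {N} = Membershipₚ.∈-tabulate⁻ (perfectMatchings G) {f = M} {v = N}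

  ∈-resp-≈ : ∀ {xs} M N → (∀ x y → joins M x y ≡ joins N x y) → M ∈ xs → N ∈ xs
  ∈-resp-≈ M N = Membershipₚ.∈-resp-≈ (perfectMatchings G) {x = M} {y = N}

  colourClass-cong : ∀ C C′ (π : Fin 3 → Fin 3) → Injective _≡_ _≡_ π →
                     (∀ x d → col C′ x d ≡ π (col C x d)) →
                     ∀ c → colourClass C c ≈ colourClass C′ (π c)
  colourClass-cong C C′ π π-inj C′≡πC c x y = T-injective
    (λ t → fromWitness (to (toWitness t)))
    (λ t → fromWitness (from (toWitness t)))
    where
    to : Joins C c x y → Joins C′ (π c) x y
    to (d , nb≡y , col≡c) = d , nb≡y , trans (C′≡πC x d) (cong π col≡c)

    from : Joins C′ (π c) x y → Joins C c x y
    from (d , nb≡y , col≡πc) = d , nb≡y , π-inj (trans (sym (C′≡πC x d)) col≡πc)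

  -- Each factor covers x₀, so the three edges at x₀ list the factors.
  module _ (F : OneFactorisation G) where

    factorAt : ∀ x d → PerfectMatching G
    factorAt x d = proj₁ (partition F (nb⇒~ x d))

    factorAt-∈ : ∀ x d → factorAt x d ∈ factors F
    factorAt-∈ x d = proj₁ (proj₁ (proj₂ (partition F (nb⇒~ x d))))

    factorAt-joins : ∀ x d → T (joins (factorAt x d) x (nb x d))
    factorAt-joins x d = proj₂ (proj₁ (proj₂ (partition F (nb⇒~ x d))))

    factorAt-unique : ∀ x d {M} → M ∈ factors F → T (joins M x (nb x d)) → factorAt x d ≈ M
    factorAt-unique x d {M} M∈ t = proj₂ (proj₂ (partition F (nb⇒~ x d))) {M} (M∈ , t)

    factorAt-covers : ∀ x {M} → M ∈ factors F → ∃ λ d → factorAt x d ≈ M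
    factorAt-covers x {M} M∈ with y , t , _ ← perfect M x with d , refl ← ~⇒nb (joins⇒~ M t) =
      d , factorAt-unique x d {M} M∈ t

    -- A matching gives `x` a single partner, so equal factors lead to the same neighbour and hence
    -- come from the same dart.
    factorAt-injective : ∀ x d d′ → factorAt x d ≈ factorAt x d′ → d ≡ d′
    factorAt-injective x d d′ ≈′ with y , _ , unique ← perfect (factorAt x d) x =
      nb-injective x (trans (sym (unique (factorAt-joins x d)))
        (unique (subst T (sym (≈′ x (nb x d′))) (factorAt-joins x d′))))

    label : ∀ x d → ∃ λ c → factorAt x₀ c ≈ factorAt x d
    label x d = factorAt-covers x₀ {factorAt x d} (factorAt-∈ x d)

    toColouring : Colouring
    toColouring .col x d = proj₁ (label x d)
    toColouring .col-injective x {d} {d′} eq = factorAt-injective x d d′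
      λ a b → trans (sym (proj₂ (label x d) a b))
        (trans (cong (λ c → joins (factorAt x₀ c) a b) eq) (proj₂ (label x d′) a b))
    -- The factor through a dart also contains the reversed dart, so it is the factor at that dart
    -- too.
    toColouring .col-op x d = factorAt-injective x₀ _ _ λ a b →
      trans (proj₂ (label y (op d)) a b)
        (trans (factorAt-unique y (op d) {factorAt x d} (factorAt-∈ x d) back a b)
          (sym (proj₂ (label x d) a b)))
      where
      y : Vertex
      y = nb x d

      back : T (joins (factorAt x d) y (nb y (op d)))
      back = subst (λ z → T (joins (factorAt x d) y z)) (sym (nb-op x d))
               (subst T (joins-sym (factorAt x d) x y) (factorAt-joins x d))

    colourClass≈factorAt : ∀ c → colourClass toColouring c ≈ factorAt x₀ c
    colourClass≈factorAt c x y = T-injective (λ t → to (toWitness t)) (λ t → fromWitness (from t))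
      where
      to : Joins toColouring c x y → T (joins (factorAt x₀ c) x y)
      to (d , refl , refl) = subst T (sym (proj₂ (label x d) x (nb x d))) (factorAt-joins x d)

      from : T (joins (factorAt x₀ c) x y) → Joins toColouring c x y
      from t with d , refl ← ~⇒nb (joins⇒~ (factorAt x₀ c) t) =
        d , refl , factorAt-injective x₀ _ _ λ a b →
          trans (proj₂ (label x d) a b)
            (factorAt-unique x d {factorAt x₀ c} (factorAt-∈ x₀ c) t a b)

  -- Abstract, so that conversion does not unfold the lists of matchings.
  abstract
    factorisation : Colouring → OneFactorisation G
    factorisation C .factors = tabulate (colourClass C)
    factorisation C .partition {x} x~y with d , refl ← ~⇒nb x~y =
        colourClass C (col C x d)
      , (factor-∈ (colourClass C) (col C x d) , fromWitness (d , refl , refl))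
      , (λ {N} → unique {N})
      where
      unique : ∀ {N} → N ∈ tabulate (colourClass C) × T (joins N x (nb x d)) →
               colourClass C (col C x d) ≈ N
      unique {N} (N∈ , t) with c , N≈ ← ∈-factor (colourClass C) {N} N∈
        with d′ , nb≡ , refl ← toWitness {a? = joins? C c x (nb x d)} (subst T (N≈ x (nb x d)) t)
        with refl ← nb-injective x nb≡ = λ x y → sym (N≈ x y)

    factorisation-cong : ∀ C C′ (π : Fin 3 → Fin 3) → Injective _≡_ _≡_ π →
                         (∀ x d → col C′ x d ≡ π (col C x d)) →
                         factorisation C ≋ factorisation C′
    factorisation-cong C C′ π π-inj C′≡πC = (λ {N} → ⊆′ {N}) , (λ {N} → ⊇′ {N})
      where
      M M′ : Fin 3 → PerfectMatching G
      M  = colourClass C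
      M′ = colourClass C′

      M≈M′ : ∀ c → M c ≈ M′ (π c)
      M≈M′ = colourClass-cong C C′ π π-inj C′≡πC

      ⊆′ : ∀ {N} → N ∈ tabulate M → N ∈ tabulate M′
      ⊆′ {N} N∈ with c , N≈ ← ∈-factor M {N} N∈ =
        ∈-resp-≈ (M′ (π c)) N (λ x y → sym (trans (N≈ x y) (M≈M′ c x y))) (factor-∈ M′ (π c))

      ⊇′ : ∀ {N} → N ∈ tabulate M′ → N ∈ tabulate M
      ⊇′ {N} N∈
        with c′ , N≈ ← ∈-factor M′ {N} N∈
        with c , refl ← injective⇒surjective π-inj c′ =
        ∈-resp-≈ (M c) N (λ x y → trans (M≈M′ c x y) (sym (N≈ x y))) (factor-∈ M c)

    -- Sending each class of `C` to an equal class of `C′` defines `π`. All three colours of `C`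
    -- occur at `x₀`, where `C′` separates the darts, so `π` is injective.
    factorisation-reflects : ∀ C C′ → factorisation C ≋ factorisation C′ →
                             ∃ λ π → Injective _≡_ _≡_ π × ∀ x d → col C′ x d ≡ π (col C x d)
    factorisation-reflects C C′ (C⊆C′ , _) = π , π-inj , C′≡πC
      where
      M M′ : Fin 3 → PerfectMatching G
      M  = colourClass C
      M′ = colourClass C′

      M≈ : ∀ c → ∃ λ c′ → M c ≈ M′ c′
      M≈ c = ∈-factor M′ {M c} (C⊆C′ {M c} (factor-∈ M c))

      π : Fin 3 → Fin 3
      π c = proj₁ (M≈ c)

      C′≡πC : ∀ x d → col C′ x d ≡ π (col C x d)
      C′≡πC x d
        with d′ , nb≡ , eq ← toWitness {a? = joins? C′ (π (col C x d)) x (nb x d)}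
               (subst T (proj₂ (M≈ (col C x d)) x (nb x d)) (fromWitness (d , refl , refl)))
        with refl ← nb-injective x nb≡ = eq

      π-inj : Injective _≡_ _≡_ π
      π-inj {a} {b} πa≡πb
        with d , refl ← injective⇒surjective (col-injective C x₀) a
        with d′ , refl ← injective⇒surjective (col-injective C x₀) b =
        cong (col C x₀) (col-injective C′ x₀
          (trans (C′≡πC x₀ d) (trans πa≡πb (sym (C′≡πC x₀ d′)))))

    factorisation-toColouring : ∀ F → factorisation (toColouring F) ≋ F
    factorisation-toColouring F = (λ {N} → ⊆′ {N}) , (λ {N} → ⊇′ {N})
      where
      M : Fin 3 → PerfectMatching G
      M = colourClass (toColouring F)

      ⊆′ : ∀ {N} → N ∈ tabulate M → N ∈ factors F
      ⊆′ {N} N∈ with c , N≈ ← ∈-factor M {N} N∈ =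
        ∈-resp-≈ (factorAt F x₀ c) N
          (λ x y → sym (trans (N≈ x y) (colourClass≈factorAt F c x y)))
          (factorAt-∈ F x₀ c)

      ⊇′ : ∀ {N} → N ∈ factors F → N ∈ tabulate M
      ⊇′ {N} N∈ with c , ≈N ← factorAt-covers F x₀ {N} N∈ =
        ∈-resp-≈ (M c) N (λ x y → trans (colourClass≈factorAt F c x y) (≈N x y))
          (factor-∈ M c)

-- Arithmetic modulo n.

module _ {n : ℕ} .{{_ : NonZero n}} where

  -- Reduces a modular identity to an equation between naturals, with `q` the number of times the
  -- sum wraps around.
  ⊕-≡ : ∀ (i : Fin n) {j} m q → toℕ i + m ≡ toℕ j + q * n → i ⊕ m ≡ j
  ⊕-≡ i {j} m q eq = toℕ-injective (begin
    toℕ (i ⊕ m)          ≡⟨ toℕ-fromℕ< (m%n<n (toℕ i + m) n) ⟩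
    (toℕ i + m) % n      ≡⟨ cong (_% n) eq ⟩
    (toℕ j + q * n) % n  ≡⟨ [m+kn]%n≡m%n (toℕ j) q n ⟩
    toℕ j % n            ≡⟨ m<n⇒m%n≡m (toℕ<n j) ⟩
    toℕ j                ∎)
    where open ≡-Reasoning

  ⊕-assoc : ∀ (i : Fin n) a b → i ⊕ a ⊕ b ≡ i ⊕ (a + b)
  ⊕-assoc i a b = toℕ-injective (begin
    toℕ (i ⊕ a ⊕ b)                ≡⟨ toℕ-fromℕ< (m%n<n (toℕ (i ⊕ a) + b) n) ⟩
    (toℕ (i ⊕ a) + b) % n          ≡⟨ cong (λ x → (x + b) % n) (toℕ-fromℕ< (m%n<n (toℕ i + a) n)) ⟩
    ((toℕ i + a) % n + b) % n      ≡⟨ %-distribˡ-+ ((toℕ i + a) % n) b n ⟩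
    ((toℕ i + a) % n % n + b % n) % n  ≡⟨ cong (λ x → (x + b % n) % n) (m%n%n≡m%n (toℕ i + a) n) ⟩
    ((toℕ i + a) % n + b % n) % n  ≡⟨ %-distribˡ-+ (toℕ i + a) b n ⟨
    (toℕ i + a + b) % n            ≡⟨ cong (_% n) (+-assoc (toℕ i) a b) ⟩
    (toℕ i + (a + b)) % n          ≡⟨ toℕ-fromℕ< (m%n<n (toℕ i + (a + b)) n) ⟨
    toℕ (i ⊕ (a + b))              ∎)
    where open ≡-Reasoning

  ⊕-n : ∀ (i : Fin n) → i ⊕ n ≡ i
  ⊕-n i = ⊕-≡ i n 1 (cong (toℕ i +_) (sym (+-identityʳ n)))

  ⊕-inverse : ∀ (i : Fin n) a b → a + b ≡ n → i ⊕ a ⊕ b ≡ i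
  ⊕-inverse i a b eq = trans (⊕-assoc i a b) (trans (cong (i ⊕_) eq) (⊕-n i))

  ⊕-≢ : ∀ (i : Fin n) a b → 0 < b → b < n → i ⊕ a ≢ i ⊕ (a + b)
  ⊕-≢ i a b 0<b b<n eq = i⊕m≢i 0<b b<n (i ⊕ a) (trans (⊕-assoc i a b) (sym eq))

  u-injective : ∀ {i j : Fin n} → u i ≡ u j → i ≡ j
  u-injective refl = refl

  v-injective : ∀ {i j : Fin n} → v i ≡ v j → i ≡ j
  v-injective refl = refl

_≟ᵥ_ : ∀ {n} → DecidableEquality (GPVertex n)
u i ≟ᵥ u j = map′ (cong u) (λ where refl → refl) (i ≟ j)
u i ≟ᵥ v j = no λ ()
v i ≟ᵥ u j = no λ ()
v i ≟ᵥ v j = map′ (cong v) (λ where refl → refl) (i ≟ j)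

-- GP(3k,k) as a cubic graph with darts.

module Petersen (k-1 : ℕ) (1≤k : 1 ≤ suc k-1) where

  -- Spelt so that `1 + n-1` and `k + 2 * k` reduce to `n`, which lets `refl` prove these sums
  -- below.
  k n n-1 : ℕ
  k = suc k-1
  n = 3 * k
  n-1 = k-1 + 2 * k

  G : SimpleGraph
  G = GP n k 1≤k (2k<3k 1≤k)

  open SimpleGraph G using (_~_)

  -- The darts are forward, backward and spoke; `_⊕_` only adds, so going back by 1 or `k` is going
  -- forward by `n-1` or `2 * k`.
  nb : GPVertex n → Fin 3 → GPVertex n
  nb (u i) 0F = u (i ⊕ 1)
  nb (u i) 1F = u (i ⊕ n-1)
  nb (u i) 2F = v i
  nb (v i) 0F = v (i ⊕ k)
  nb (v i) 1F = v (i ⊕ 2 * k)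
  nb (v i) 2F = u i

  op : Fin 3 → Fin 3
  op 0F = 1F
  op 1F = 0F
  op 2F = 2F

  n-1+1≡n : n-1 + 1 ≡ n
  n-1+1≡n = +-comm n-1 1

  2k+k≡n : 2 * k + k ≡ n
  2k+k≡n = +-comm (2 * k) k

  nb-op : ∀ x d → nb (nb x d) (op d) ≡ x
  nb-op (u i) 0F = cong u (⊕-inverse i 1 n-1 refl)
  nb-op (u i) 1F = cong u (⊕-inverse i n-1 1 n-1+1≡n)
  nb-op (u i) 2F = refl
  nb-op (v i) 0F = cong v (⊕-inverse i k (2 * k) refl)
  nb-op (v i) 1F = cong v (⊕-inverse i (2 * k) k 2k+k≡n)
  nb-op (v i) 2F = refl

  nb-injective : ∀ x → Injective _≡_ _≡_ (nb x)
  nb-injective (u i) = Distinct⇒Injective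
    ((λ eq → ⊕-≢ i 1 b 0<1+n b<n (trans (u-injective eq) (cong (i ⊕_) (n-1≡1+b k-1)))) , (λ ()) , λ ())
    where
    -- `b` is `n` minus 2, the distance from the next outer vertex on to the previous one.
    b : ℕ
    b = suc (k-1 + (k-1 + k-1))

    n-1≡1+b : ∀ a → a + 2 * suc a ≡ 1 + suc (a + (a + a))
    n-1≡1+b = solve-∀

    b+2≡n : ∀ a → suc (a + (a + a)) + 2 ≡ 3 * suc a
    b+2≡n = solve-∀

    b<n : b < n
    b<n = subst (b <_) (b+2≡n k-1) (m<m+n b 0<1+n)
  nb-injective (v i) = Distinct⇒Injective
    -- `2 * k` unfolds to `k + (k + 0)`, so the two inner neighbours differ by `k + 0`.
    ((λ eq → ⊕-≢ i k (k + 0) 0<1+n k+0<n (v-injective eq)) , (λ ()) , λ ())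
    where
    k+0<n : k + 0 < n
    k+0<n = subst (k + 0 <_) (cong (_+ 2 * k) (+-identityʳ k)) (m<m+n (k + 0) 0<1+n)

  nb⇒~ : ∀ x d → x ~ nb x d
  nb⇒~ (u i) 0F = fwd (outer refl)
  nb⇒~ (u i) 1F = bwd (outer (⊕-inverse i n-1 1 n-1+1≡n))
  nb⇒~ (u i) 2F = fwd spoke
  nb⇒~ (v i) 0F = fwd (inner refl)
  nb⇒~ (v i) 1F = bwd (inner (⊕-inverse i (2 * k) k 2k+k≡n))
  nb⇒~ (v i) 2F = bwd spoke

  ~⇒nb : ∀ {x y} → x ~ y → ∃ λ d → nb x d ≡ y
  ~⇒nb (fwd (outer refl)) = 0F , refl
  ~⇒nb (fwd spoke)        = 2F , refl
  ~⇒nb (fwd (inner refl)) = 0F , refl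
  ~⇒nb {y = u i} (bwd (outer refl)) = 1F , cong u (⊕-inverse i 1 n-1 refl)
  ~⇒nb (bwd spoke)        = 2F , refl
  ~⇒nb {y = v i} (bwd (inner refl)) = 1F , cong v (⊕-inverse i k (2 * k) refl)

  open Cubic G _≟ᵥ_ nb nb-injective op nb-op nb⇒~ ~⇒nb (u 0F) public
  open Colouring public

  -- Rows and columns of indices.

  -- Row j and column r stand for the index j k + r; stepping past the last row
  -- subtracts 3k once.
  wraps : Fin 3 → ℕ
  wraps 0F = 0
  wraps 1F = 0
  wraps 2F = 1

  carry : ∀ j k r → k * toℕ j + r + k ≡ k * toℕ (j ⊕ 1) + r + wraps j * (3 * k)
  carry 0F = carry₀
    where
    carry₀ : ∀ k r → k * 0 + r + k ≡ k * 1 + r + 0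
    carry₀ = solve-∀
  carry 1F = carry₁
    where
    carry₁ : ∀ k r → k * 1 + r + k ≡ k * 2 + r + 0
    carry₁ = solve-∀
  carry 2F = carry₂
    where
    carry₂ : ∀ k r → k * 2 + r + k ≡ k * 0 + r + 1 * (3 * k)
    carry₂ = solve-∀

  -- Inner edges change the row and keep the column, so each column carries one inner triangle.
  combine-⊕k : ∀ (j : Fin 3) (r : Fin k) → combine j r ⊕ k ≡ combine (j ⊕ 1) r
  combine-⊕k j r = ⊕-≡ (combine j r) k (wraps j) (begin
    toℕ (combine j r) + k                    ≡⟨ cong (_+ k) (toℕ-combine j r) ⟩
    k * toℕ j + toℕ r + k                    ≡⟨ carry j k (toℕ r) ⟩
    k * toℕ (j ⊕ 1) + toℕ r + wraps j * n    ≡⟨ cong (_+ wraps j * n) (toℕ-combine (j ⊕ 1) r) ⟨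
    toℕ (combine (j ⊕ 1) r) + wraps j * n    ∎)
    where open ≡-Reasoning

  combine-⊕1 : ∀ (j : Fin 3) (r : Fin k-1) → combine j (inject₁ r) ⊕ 1 ≡ combine j (suc r)
  combine-⊕1 j r = ⊕-≡ (combine j (inject₁ r)) 1 0 (begin
    toℕ (combine j (inject₁ r)) + 1  ≡⟨ cong (_+ 1) (toℕ-combine j (inject₁ r)) ⟩
    k * toℕ j + toℕ (inject₁ r) + 1  ≡⟨ cong (λ x → k * toℕ j + x + 1) (toℕ-inject₁ r) ⟩
    k * toℕ j + toℕ r + 1            ≡⟨ +-assoc (k * toℕ j) (toℕ r) 1 ⟩
    k * toℕ j + (toℕ r + 1)          ≡⟨ cong (k * toℕ j +_) (+-comm (toℕ r) 1) ⟩
    k * toℕ j + toℕ (suc r)          ≡⟨ toℕ-combine j (suc r) ⟨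
    toℕ (combine j (suc r))          ≡⟨ +-identityʳ _ ⟨
    toℕ (combine j (suc r)) + 0      ∎)
    where open ≡-Reasoning

  -- The outer cycle runs from the end of a row to the start of the next; this is the source of the
  -- rotation when a sequence closes.
  combine-last-⊕1 : ∀ (j : Fin 3) → combine j (fromℕ k-1) ⊕ 1 ≡ combine (j ⊕ 1) (zero {k-1})
  combine-last-⊕1 j = ⊕-≡ (combine j (fromℕ k-1)) 1 (wraps j) (begin
    toℕ (combine j (fromℕ k-1)) + 1                     ≡⟨ cong (_+ 1) (toℕ-combine j (fromℕ k-1)) ⟩
    k * toℕ j + toℕ (fromℕ k-1) + 1                     ≡⟨ cong (λ x → k * toℕ j + x + 1) (toℕ-fromℕ k-1) ⟩
    k * toℕ j + k-1 + 1                                 ≡⟨ last+1 (k * toℕ j) k-1 ⟩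
    k * toℕ j + 0 + k                                   ≡⟨ carry j k 0 ⟩
    k * toℕ (j ⊕ 1) + 0 + wraps j * n                   ≡⟨ cong (_+ wraps j * n) (toℕ-combine (j ⊕ 1) (zero {k-1})) ⟨
    toℕ (combine (j ⊕ 1) (zero {k-1})) + wraps j * n    ∎)
    where
    open ≡-Reasoning

    last+1 : ∀ a b → a + b + 1 ≡ a + 0 + suc b
    last+1 = solve-∀

  abstract
    -- Kept abstract so that it is evaluated only through `coords-combine`.
    coords : Fin n → Fin 3 × Fin k
    coords = remQuot k

    coords-combine : ∀ j r → coords (combine j r) ≡ (j , r)
    coords-combine = remQuot-combine

  -- From closed sequences of states to colourings.

  Sequence : Set
  Sequence = Fin (suc k) → State

  -- Entry `k` holds the outer edges leaving the last column, which enter column 0 one row further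
  -- on.
  record Valid (E : Sequence) : Set where
    field
      steps  : ∀ r → Step (E (inject₁ r)) (E (suc r))
      closes : ∀ j → E (fromℕ k) j ≡ E zero (j ⊕ 1)

  open Valid

  spoke-colour : Sequence → Fin 3 × Fin k → Fin 3
  spoke-colour E (j , r) = third (E (inject₁ r) j) (E (suc r) j)

  -- An edge of an inner triangle takes the colour of the spoke at the opposite vertex: the edge
  -- from row `j` to `j ⊕ 1` faces row `j ⊕ 2`, and vice versa.
  u-colour v-colour : Sequence → Fin 3 × Fin k → Fin 3 → Fin 3
  u-colour E (j , r) 0F = E (suc r) j
  u-colour E (j , r) 1F = E (inject₁ r) j
  u-colour E (j , r) 2F = spoke-colour E (j , r)
  v-colour E (j , r) 0F = spoke-colour E (j ⊕ 2 , r)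
  v-colour E (j , r) 1F = spoke-colour E (j ⊕ 1 , r)
  v-colour E (j , r) 2F = spoke-colour E (j , r)

  dart-colour : Sequence → GPVertex n → Fin 3 → Fin 3
  dart-colour E (u i) = u-colour E (coords i)
  dart-colour E (v i) = v-colour E (coords i)

  module _ {E : Sequence} (valid : Valid E) where

    spoke-injective : ∀ r → Injective _≡_ _≡_ (λ j → spoke-colour E (j , r))
    spoke-injective r = Distinct⇒Injective (proj₂ (steps valid r))

    u-colour-injective : ∀ jr → Injective _≡_ _≡_ (u-colour E jr)
    u-colour-injective (j , r) = Distinct⇒Injective
      (≢ ∘ sym , proj₁ (third-≢ _ _ ≢) , proj₂ (third-≢ _ _ ≢))
      where
      ≢ : E (inject₁ r) j ≢ E (suc r) j
      ≢ = proj₁ (steps valid r) j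

    v-colour-injective : ∀ jr → Injective _≡_ _≡_ (v-colour E jr)
    v-colour-injective (j , r) = Distinct⇒Injective
      ( (λ eq → ⊕-≢ j 1 1 0<1+n (s≤s (s≤s z≤n)) (sym (spoke-injective r eq)))
      , (λ eq → x⊕1≢x j (spoke-injective r eq))
      , (λ eq → x⊕2≢x j (spoke-injective r eq)))

    u-colour-⊕1 : ∀ i → u-colour E (coords (i ⊕ 1)) 1F ≡ u-colour E (coords i) 0F
    u-colour-⊕1 i with j , r , refl ← combine-surjective {3} {k} i
      rewrite coords-combine j r with view r
    ... | ‵inject₁ r rewrite combine-⊕1 j r | coords-combine j (suc r) = refl
    -- Past the last column the edge enters the next row, where `closes` identifies the colours.
    ... | ‵fromℕ rewrite combine-last-⊕1 j | coords-combine (j ⊕ 1) zero =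
      sym (closes valid j)

    v-colour-⊕k : ∀ i → v-colour E (coords (i ⊕ k)) 1F ≡ v-colour E (coords i) 0F
    v-colour-⊕k i with j , r , refl ← combine-surjective {3} {k} i
      rewrite coords-combine j r | combine-⊕k j r | coords-combine (j ⊕ 1) r =
      cong (λ j → spoke-colour E (j , r)) (⊕-assoc j 1 1)

    colouring : Colouring
    colouring .col = dart-colour E
    colouring .col-injective (u i) = u-colour-injective (coords i)
    colouring .col-injective (v i) = v-colour-injective (coords i)
    colouring .col-op (u i) 0F = u-colour-⊕1 i
    colouring .col-op (u i) 1F = begin
      dart-colour E (u (i ⊕ n-1)) 0F      ≡⟨ u-colour-⊕1 (i ⊕ n-1) ⟨
      dart-colour E (u (i ⊕ n-1 ⊕ 1)) 1F  ≡⟨ cong (λ i → dart-colour E (u i) 1F) (⊕-inverse i n-1 1 n-1+1≡n) ⟩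
      dart-colour E (u i) 1F              ∎
      where open ≡-Reasoning
    colouring .col-op (u i) 2F = refl
    colouring .col-op (v i) 0F = v-colour-⊕k i
    colouring .col-op (v i) 1F = begin
      dart-colour E (v (i ⊕ 2 * k)) 0F      ≡⟨ v-colour-⊕k (i ⊕ 2 * k) ⟨
      dart-colour E (v (i ⊕ 2 * k ⊕ k)) 1F  ≡⟨ cong (λ i → dart-colour E (v i) 1F) (⊕-inverse i (2 * k) k 2k+k≡n) ⟩
      dart-colour E (v i) 1F                ∎
      where open ≡-Reasoning
    colouring .col-op (v i) 2F = refl

  spoke-colour-cong : ∀ {E E′} → (∀ r j → E r j ≡ E′ r j) → ∀ jr → spoke-colour E jr ≡ spoke-colour E′ jr
  spoke-colour-cong E≗E′ (j , r) = cong₂ third (E≗E′ (inject₁ r) j) (E≗E′ (suc r) j)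

  dart-colour-cong : ∀ {E E′} → (∀ r j → E r j ≡ E′ r j) → ∀ x d → dart-colour E x d ≡ dart-colour E′ x d
  dart-colour-cong E≗E′ (u i) 0F = E≗E′ _ _
  dart-colour-cong E≗E′ (u i) 1F = E≗E′ _ _
  dart-colour-cong E≗E′ (u i) 2F = spoke-colour-cong E≗E′ _
  dart-colour-cong E≗E′ (v i) 0F = spoke-colour-cong E≗E′ _
  dart-colour-cong E≗E′ (v i) 1F = spoke-colour-cong E≗E′ _
  dart-colour-cong E≗E′ (v i) 2F = spoke-colour-cong E≗E′ _

  -- From colourings to closed sequences of states.

  sequence : (GPVertex n → Fin 3 → Fin 3) → Sequence
  sequence c zero    j = c (u (combine j zero)) 1F
  -- There is no column `k`, so every entry after the first is read from the edges leaving a column.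
  sequence c (suc r) j = c (u (combine j r)) 0F

  sequence-dart-colour : ∀ E r j → sequence (dart-colour E) r j ≡ E r j
  sequence-dart-colour E zero    j rewrite coords-combine j zero = refl
  sequence-dart-colour E (suc r) j rewrite coords-combine j r    = refl

  module _ (C : Colouring) where

    private
      E : Sequence
      E = sequence (col C)

    sequence-inject₁ : ∀ r j → E (inject₁ r) j ≡ col C (u (combine j r)) 1F
    sequence-inject₁ zero    j = refl
    sequence-inject₁ (suc r) j = begin
      col C (u (combine j (inject₁ r))) 0F      ≡⟨ col-op C (u (combine j (inject₁ r))) 0F ⟨
      col C (u (combine j (inject₁ r) ⊕ 1)) 1F  ≡⟨ cong (λ i → col C (u i) 1F) (combine-⊕1 j r) ⟩
      col C (u (combine j (suc r))) 1F          ∎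
      where open ≡-Reasoning

    sequence-closes : ∀ j → E (fromℕ k) j ≡ E zero (j ⊕ 1)
    sequence-closes j = begin
      col C (u (combine j (fromℕ k-1))) 0F      ≡⟨ col-op C (u (combine j (fromℕ k-1))) 0F ⟨
      col C (u (combine j (fromℕ k-1) ⊕ 1)) 1F  ≡⟨ cong (λ i → col C (u i) 1F) (combine-last-⊕1 j) ⟩
      col C (u (combine (j ⊕ 1) zero)) 1F       ∎
      where open ≡-Reasoning

    sequence-≢ : ∀ r j → E (inject₁ r) j ≢ E (suc r) j
    sequence-≢ r j eq = contradiction
      (col-injective C (u (combine j r)) (trans (sym (sequence-inject₁ r j)) eq)) λ ()

    spoke-colour-sequence : ∀ r j → spoke-colour E (j , r) ≡ col C (u (combine j r)) 2F
    spoke-colour-sequence r j = third-unique _ _ _ (sequence-≢ r j)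
      (λ eq → contradiction (col-injective C x (trans (sym (sequence-inject₁ r j)) eq)) λ ())
      (λ eq → contradiction (col-injective C x eq) λ ())
      where x = u (combine j r)

    private
      module _ (r : Fin k) where

        -- Colours around the inner triangle of column `r`: `s` on the spokes, `t j` on the edge
        -- from row `j` to row `j ⊕ 1`.
        s t : Fin 3 → Fin 3
        s j = col C (v (combine j r)) 2F
        t j = col C (v (combine j r)) 0F

        t-⊕1 : ∀ j → col C (v (combine (j ⊕ 1) r)) 1F ≡ t j
        t-⊕1 j = begin
          col C (v (combine (j ⊕ 1) r)) 1F  ≡⟨ cong (λ i → col C (v i) 1F) (combine-⊕k j r) ⟨
          col C (v (combine j r ⊕ k)) 1F    ≡⟨ col-op C (v (combine j r)) 0F ⟩
          t j                               ∎
          where open ≡-Reasoning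

        t-⊕2 : ∀ j → col C (v (combine j r)) 1F ≡ t (j ⊕ 2)
        t-⊕2 j = trans (cong (λ j → col C (v (combine j r)) 1F) (sym (⊕-inverse j 2 1 refl))) (t-⊕1 (j ⊕ 2))

        ⊕2⊕2 : (j : Fin 3) → j ⊕ 2 ⊕ 2 ≡ j ⊕ 1
        ⊕2⊕2 j = trans (⊕-assoc j 2 2) (trans (sym (⊕-assoc j 1 3)) (⊕-n (j ⊕ 1)))

        t≢s : ∀ j → t j ≢ s j
        t≢s j eq = contradiction (col-injective C (v (combine j r)) eq) λ ()

        t⊕2≢s : ∀ j → t (j ⊕ 2) ≢ s j
        t⊕2≢s j eq = contradiction (col-injective C (v (combine j r)) (trans (t-⊕2 j) eq)) λ ()

        t≢t⊕2 : ∀ j → t j ≢ t (j ⊕ 2)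
        t≢t⊕2 j eq = contradiction (col-injective C (v (combine j r)) (trans eq (sym (t-⊕2 j)))) λ ()

        t⊕1≢t : ∀ j → t (j ⊕ 1) ≢ t j
        t⊕1≢t j eq = t≢t⊕2 (j ⊕ 1) (trans eq (cong t (sym (⊕-inverse j 1 2 refl))))

        -- An edge of a triangle and the spoke at the opposite vertex both avoid
        -- the colours of the two other edges.
        opposite : ∀ j → t j ≡ s (j ⊕ 2)
        opposite j = trans
          (sym (third-unique (t (j ⊕ 1)) (t (j ⊕ 2)) (t j)
            (λ eq → t≢t⊕2 (j ⊕ 2) (trans (sym eq) (cong t (sym (⊕2⊕2 j)))))
            (t⊕1≢t j) (t≢t⊕2 j ∘ sym)))
          (third-unique (t (j ⊕ 1)) (t (j ⊕ 2)) (s (j ⊕ 2))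
            (λ eq → t≢t⊕2 (j ⊕ 2) (trans (sym eq) (cong t (sym (⊕2⊕2 j)))))
            (λ eq → t⊕2≢s (j ⊕ 2) (trans (cong t (⊕2⊕2 j)) eq))
            (t≢s (j ⊕ 2)))

        -- By `opposite` the spokes carry the colours of the triangle's edges, any two of which meet
        -- at a vertex.
        s-distinct : Distinct s
        s-distinct =
          (λ eq → t⊕1≢t 1F (trans (opposite 2F) (trans (sym eq) (sym (opposite 1F))))) ,
          (λ eq → t⊕1≢t 2F (trans (opposite 0F) (trans (sym eq) (sym (opposite 2F))))) ,
          (λ eq → t⊕1≢t 0F (trans (opposite 1F) (trans eq (sym (opposite 0F)))))

    spoke-colour-s : ∀ r j → spoke-colour E (j , r) ≡ s r j
    spoke-colour-s r j = trans (spoke-colour-sequence r j) (sym (col-op C (u (combine j r)) 2F))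

    sequence-valid : Valid E
    sequence-valid .steps r = sequence-≢ r , Injective⇒Distinct λ {i} {j} eq →
      Distinct⇒Injective (s-distinct r) (trans (sym (spoke-colour-s r i)) (trans eq (spoke-colour-s r j)))
    sequence-valid .closes = sequence-closes

    dart-colour-sequence : ∀ x d → dart-colour E x d ≡ col C x d
    dart-colour-sequence (u i) d with j , r , refl ← combine-surjective {3} {k} i
      rewrite coords-combine j r with d
    ... | 0F = refl
    ... | 1F = sequence-inject₁ r j
    ... | 2F = spoke-colour-sequence r j
    dart-colour-sequence (v i) d with j , r , refl ← combine-surjective {3} {k} i
      rewrite coords-combine j r with d
    ... | 0F = trans (spoke-colour-s r (j ⊕ 2)) (sym (opposite r j))
    ... | 1F = begin
      spoke-colour E (j ⊕ 1 , r)    ≡⟨ spoke-colour-s r (j ⊕ 1) ⟩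
      s r (j ⊕ 1)                   ≡⟨ cong (s r) (⊕2⊕2 r j) ⟨
      s r (j ⊕ 2 ⊕ 2)               ≡⟨ opposite r (j ⊕ 2) ⟨
      t r (j ⊕ 2)                   ≡⟨ t-⊕2 r j ⟨
      col C (v (combine j r)) 1F    ∎
      where open ≡-Reasoning
    ... | 2F = spoke-colour-s r j

  -- Closed sequences in normal form as walks.

  walk-valid : ∀ t (w : Walk (end t) k (start t)) → t Closes phase false k → Valid (states t false w)
  walk-valid t w t-closes .steps = states-step t false w
  walk-valid t w t-closes .closes j = trans (cong (λ S → S j) (states-end t false w))
    (ρ-closes t (phase false k) t-closes j)

  -- The last state traced is the first one rotated, and `ρ-closes⁻¹` reads off from this both the
  -- end of the walk and the parity condition.
  valid-walk : ∀ {E} t → Valid E → (∀ j → ρ t false (start t) j ≡ E zero j) →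
               t Closes phase false k ×
               ∃ λ (w : Walk (end t) k (start t)) → ∀ r j → states t false w r j ≡ E r j
  valid-walk {E} t valid E₀
    with y , w , eq ← walk k t false E E₀ (steps valid)
    with refl , t-closes ← ρ-closes⁻¹ t (phase false k) y (λ j →
      trans (cong (λ S → S j) (sym (states-end t false w)))
        (trans (eq (fromℕ k) j) (trans (closes valid j) (sym (E₀ (j ⊕ 1)))))) =
    t-closes , w , eq

  -- Bijection between walks and 1-factorisations.

  -- m counts the types t of initial states for which a walk of length k closes up.
  module _ {m} (type : Fin m → Fin 4) (type-injective : Injective _≡_ _≡_ type)
    (type-closes : ∀ a → type a Closes phase false k)
    (type-covers : ∀ t → t Closes phase false k → ∃ λ a → type a ≡ t)
    where

    open Setoid (oneFactorisations G) using ()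
      renaming (_≈_ to _≋_; refl to ≋-refl; sym to ≋-sym; trans to ≋-trans)

    Code : Set
    Code = Σ (Fin m) λ a → Walk (end (type a)) k (start (type a))

    -- In every type the start and the end of the walk differ, so each type contributes `J k` walks.
    Fin↔Code : Fin (m * J k) ↔ Code
    Fin↔Code = cong↔ (↔-id (Fin m)) (λ {a} → Fin↔walks (type a)) ↔-∘ *↔×
      where
      Fin↔walks : ∀ t → Fin (J k) ↔ Walk (end t) k (start t)
      Fin↔walks t = subst (λ N → Fin N ↔ Walk (end t) k (start t))
        (#walks-≢ k (x⊕2≢x (start t) ∘ sym)) (Fin↔Walk (end t) k (start t))

    decode : Code → OneFactorisation G
    decode (a , w) = factorisation (colouring (walk-valid (type a) w (type-closes a)))

    -- Equal factorisations come from colourings that differ by a permutation of colours. Both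
    -- sequences start in normal form, so the types agree, the permutation is the identity, and the
    -- states determine the walk.
    decode-injective : ∀ {c c′} → decode c ≋ decode c′ → c ≡ c′
    decode-injective {a , w} {a′ , w′} eq = codes≡ (factorisation-reflects C C′ eq)
      where
      C  = colouring (walk-valid (type a) w (type-closes a))
      C′ = colouring (walk-valid (type a′) w′ (type-closes a′))

      codes≡ : (∃ λ π → Injective _≡_ _≡_ π × ∀ x d → col C′ x d ≡ π (col C x d)) →
               (a , w) ≡ (a′ , w′)
      codes≡ (π , π-inj , C′≡πC) =
        types≡ (normal-unique (type a) (type a′) π (Injective⇒Distinct π-inj) (states≡ zero))
        where
        sequence≡ : ∀ r j → sequence (col C′) r j ≡ π (sequence (col C) r j)
        sequence≡ zero    j = C′≡πC (u (combine j zero)) 1F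
        sequence≡ (suc r) j = C′≡πC (u (combine j r)) 0F

        states≡ : ∀ r j → states (type a′) false w′ r j ≡ π (states (type a) false w r j)
        states≡ r j = begin
          states (type a′) false w′ r j      ≡⟨ sequence-dart-colour _ r j ⟨
          sequence (col C′) r j              ≡⟨ sequence≡ r j ⟩
          π (sequence (col C) r j)           ≡⟨ cong π (sequence-dart-colour _ r j) ⟩
          π (states (type a) false w r j)    ∎
          where open ≡-Reasoning

        types≡ : type a ≡ type a′ × (∀ c → π c ≡ c) → (a , w) ≡ (a′ , w′)
        types≡ (t≡t′ , π≡id) = walks≡ (type-injective t≡t′) w′ λ r j → trans (states≡ r j) (π≡id _)
          where
          -- Generalised over `a′`, so that `refl` can be matched although the type of `w′` depends
          -- on it.
          walks≡ : ∀ {a′} → a ≡ a′ → (w′ : Walk (end (type a′)) k (start (type a′))) →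
                   (∀ r j → states (type a′) false w′ r j ≡ states (type a) false w r j) →
                   (a , w) ≡ (a′ , w′)
          walks≡ refl w′ eq = cong (a ,_) (states-injective (type a) false w w′ λ r j → sym (eq r j))

    -- Permuting the colours of `toColouring F` brings the first state into normal form without
    -- changing the factorisation; the permuted colouring is then traced by a walk.
    decode-surjective : ∀ F → ∃ λ c → decode c ≋ F
    decode-surjective F = normalised
      (normalise (sequence (col C) zero) (sequence (col C) (suc zero))
        (steps (sequence-valid C) zero))
      where
      C : Colouring
      C = toColouring F

      normalised : (∃₂ λ t π → Distinct π × (∀ j → ρ t false (start t) j ≡ π (sequence (col C) zero j))) →
                   ∃ λ c → decode c ≋ F
      normalised (t , π , π-distinct , E₀) = coded (valid-walk t (sequence-valid πC) E₀)
        where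
        π-inj : Injective _≡_ _≡_ π
        π-inj = Distinct⇒Injective π-distinct

        πC : Colouring
        πC = relabel π π-inj C

        coded : (t Closes phase false k × ∃ λ (w : Walk (end t) k (start t)) →
                 ∀ r j → states t false w r j ≡ sequence (col πC) r j) →
                ∃ λ c → decode c ≋ F
        coded (t-closes , w , eq) = typed (type-covers t t-closes) w eq
          where
          typed : (∃ λ a → type a ≡ t) → (w : Walk (end t) k (start t)) →
                  (∀ r j → states t false w r j ≡ sequence (col πC) r j) →
                  ∃ λ c → decode c ≋ F
          typed (a , refl) w eq = (a , w) ,
            ≋-trans {decode (a , w)} {factorisation πC} {F}
              (factorisation-cong (colouring (walk-valid t w (type-closes a))) πC id id λ x d →
                trans (sym (dart-colour-sequence πC x d)) (dart-colour-cong (λ r j → sym (eq r j)) x d))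
              (≋-trans {factorisation πC} {factorisation C} {F}
                (≋-sym {factorisation C} {factorisation πC} (factorisation-cong C πC π π-inj λ _ _ → refl))
                (factorisation-toColouring F))

    cardinality : HasCardinality (oneFactorisations G) (m * J k)
    cardinality = bijection (Inverse⇒Bijection Fin↔Code) record
      { to        = decode
      ; cong      = decode-cong
      ; bijective = decode-injective , λ F →
          map₂ (λ decode≋F → λ where refl → decode≋F) (decode-surjective F)
      }
      where
      decode-cong : ∀ {c c′} → c ≡ c′ → decode c ≋ decode c′
      decode-cong {c} refl = ≋-refl {decode c}

theorem1 : ∀ (k : ℕ) (1≤k : 1 ≤ k) →
    (¬ (2 ∣ k) → HasCardinality (oneFactorisations (GP (3 * k) k 1≤k (2k<3k 1≤k))) (J k)) ×
    (2 ∣ k → HasCardinality (oneFactorisations (GP (3 * k) k 1≤k (2k<3k 1≤k))) (4 * J k))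
theorem1 k@(suc k-1) 1≤k = odd , even
  where
  open Petersen k-1 1≤k using (G; cardinality)

  odd : ¬ (2 ∣ k) → HasCardinality (oneFactorisations G) (J k)
  -- For odd `k` only type 0 closes up; `1 * J k` reduces to `J k + 0`.
  odd ∤k = subst (HasCardinality (oneFactorisations G)) (+-identityʳ (J k))
    (cardinality {1} (λ _ → 0F) one-type (λ _ → inj₁ refl) covers)
    where
    one-type : Injective {A = Fin 1} {B = Fin 4} _≡_ _≡_ (λ _ → 0F)
    one-type {0F} {0F} _ = refl

    covers : ∀ t → t Closes phase false k → ∃ λ (_ : Fin 1) → 0F ≡ t
    covers _ (inj₁ refl) = 0F , refl
    covers _ (inj₂ even) = contradiction (phase-even k even) ∤k

  even : 2 ∣ k → HasCardinality (oneFactorisations G) (4 * J k)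
  -- For even `k` the phase returns to `false`, so all four types close up.
  even ∣k = cardinality id id (λ _ → inj₂ (even-phase ∣k)) λ t _ → t , refl
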